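{- Let $\varepsilon>0$ and let $\mathcal{P}$ be any bounded-derivative property of functions $f:[n]\to\mathbb{R}$. There is a distribution-free tester for $\mathcal{P}$ with proximity parameter $\varepsilon$ making $24\,\varepsilon^{ -1}\log n$ queries.
   Context: A bounded-derivative property on $[n]$ is $\mathcal{P}=\{g:[n]\to\mathbb{R}: l(t)\le g(t+1)-g(t)\le u(t)\ \forall t\in[n-1]\}$ for some $l,u:[n-1]\to\mathbb{R}$ with $l(t)<u(t)$. A distribution-free tester does not know the distribution $\mathcal{D}$ on $[n]$ but may draw independent samples from it and query $f$ anywhere; for every $\mathcal{D}$ it must accept with probability $>2/3$ if $f\in\mathcal{P}$ and reject with probability $>2/3$ if $\min_{g\in\mathcal{P}}\Pr_{x\sim\mathcal{D}}[f(x)\ne g(x)]>\varepsilon$. -}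

module Defs where

open import Algebra.Bundles using (CommutativeRing)
open import Algebra.Structures using (IsCommutativeRing)
import Algebra.Definitions.RawMonoid as RawMonoidDefinitions
import Algebra.Properties.Monoid.Mult as MonoidMult
import Algebra.Properties.Semiring.Mult as SemiringMult
open import Data.Bool.Base using (Bool; true; false; if_then_else_)
import Data.Bool.Properties as Bool
open import Data.Fin.Base using (Fin; suc; inject₁)
open import Data.Nat.Base as ℕ using (ℕ; zero; suc; NonZero)
import Data.Nat.Properties as ℕ
open import Data.Product.Base using (∃; ∃-syntax; _×_; _,_; proj₁)
open import Data.Sum.Base using (inj₁; inj₂)
open import Data.Vec.Functional using (Vector; foldr)
open import Level using (Level) renaming (suc to lsuc)
open import Relation.Binary.Core using (Rel)
open import Relation.Binary.Definitions using (tri<; tri≈; tri>)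
import Relation.Binary.Construct.StrictToNonStrict as StrictToNonStrict
open import Relation.Binary.PropositionalEquality
open import Relation.Binary.Structures using (IsStrictTotalOrder)
open import Relation.Nullary.Decidable.Core using (¬?; does)
open import Relation.Nullary.Negation.Core using (¬_; contradiction)
open import Relation.Unary using (Pred; Decidable; _∈_)

-- The real numbers, axiomatised as a Dedekind-complete totally ordered field.
-- Equality is propositional, so every function out of the reals respects it.
-- Trichotomy is part of IsStrictTotalOrder: these are the classical reals.
record RealNumbers (r : Level) : Set (lsuc r) where
  infix  4 _<_
  infixl 6 _+_
  infixl 7 _*_
  infix  8 -_
  infix  9 _⁻¹
  field
    ℝ                  : Set r
    _<_                : Rel ℝ r
    _+_ _*_            : ℝ → ℝ → ℝ
    -_                 : ℝ → ℝ
    0# 1#              : ℝ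
    -- Total; nothing is assumed about 0# ⁻¹.
    _⁻¹                : ℝ → ℝ
    isCommutativeRing  : IsCommutativeRing _≡_ _+_ _*_ -_ 0# 1#
    ⁻¹-inverseʳ        : ∀ {x} → x ≢ 0# → x * x ⁻¹ ≡ 1#
    isStrictTotalOrder : IsStrictTotalOrder _≡_ _<_
    0<1                : 0# < 1#
    +-monoˡ-<          : ∀ z {x y} → x < y → x + z < y + z
    *-monoˡ-<          : ∀ {z x y} → 0# < z → x < y → x * z < y * z

  open StrictToNonStrict _≡_ _<_ public using (_≤_)

  IsUpperBound : Pred ℝ r → ℝ → Set r
  IsUpperBound S b = ∀ {x} → x ∈ S → x ≤ b

  -- Every number below a supremum is exceeded by an element of the set. This
  -- is classically the same as being least among the upper bounds, but it
  -- provides the element.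
  IsSupremum : Pred ℝ r → ℝ → Set r
  IsSupremum S s = IsUpperBound S s × (∀ {y} → y < s → ∃[ x ] x ∈ S × y < x)

  field
    supremum : (S : Pred ℝ r) → ∃ S → ∃ (IsUpperBound S) → ∃ (IsSupremum S)

module RealArithmetic {r} (𝓡 : RealNumbers r) where

  open RealNumbers 𝓡 public

  commutativeRing : CommutativeRing r r
  commutativeRing = record { isCommutativeRing = isCommutativeRing }

  open CommutativeRing commutativeRing public
    using (_-_; +-identityˡ; *-assoc; *-comm; *-identityʳ)
  open IsStrictTotalOrder isStrictTotalOrder public
    using (_≟_; compare) renaming (trans to <-trans; irrefl to <-irrefl)

  open RawMonoidDefinitions (CommutativeRing.+-rawMonoid commutativeRing) public
    using (sum)

  open MonoidMult (CommutativeRing.+-monoid commutativeRing) public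
    using () renaming (_×_ to _·_)

  fromℕ : ℕ → ℝ
  fromℕ n = n · 1#

  infixl 7 _/_
  _/_ : ℝ → ℝ → ℝ
  x / y = x * y ⁻¹

  IsMinimum : Pred ℝ r → ℝ → Set r
  IsMinimum S d = d ∈ S × (∀ {x} → x ∈ S → d ≤ x)

  fromℕ-<-suc : ∀ n → fromℕ n < fromℕ (suc n)
  fromℕ-<-suc n = subst (_< fromℕ (suc n)) (+-identityˡ _) (+-monoˡ-< (fromℕ n) 0<1)

  fromℕ-mono-< : ∀ {m n} → m ℕ.<′ n → fromℕ m < fromℕ n
  fromℕ-mono-< {m} ℕ.<′-base                  = fromℕ-<-suc m
  fromℕ-mono-< {n = suc n} (ℕ.≤′-step m<n) = <-trans (fromℕ-mono-< m<n) (fromℕ-<-suc n)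

  fromℕ-pos : ∀ n → 0# < fromℕ (suc n)
  fromℕ-pos n = fromℕ-mono-< {0} {suc n} (ℕ.<⇒<′ ℕ.z<s)

  fromℕ-≮ : ∀ {m n} → m ℕ.≤ n → ¬ (fromℕ n < fromℕ m)
  fromℕ-≮ m≤n n<m with ℕ.m≤n⇒m<n∨m≡n m≤n
  ... | inj₁ m<n  = <-irrefl refl (<-trans n<m (fromℕ-mono-< (ℕ.<⇒<′ m<n)))
  ... | inj₂ refl = <-irrefl refl n<m

  -- The quotients a / b with 2^(a / b) ≤ n.
  Log₂Below : ℕ → Pred ℝ r
  Log₂Below n x = ∃[ a ] ∃[ b ] 2 ℕ.^ a ℕ.≤ n ℕ.^ suc b × x ≡ fromℕ a / fromℕ (suc b)

  log₂Below-inhabited : ∀ n .{{_ : NonZero n}} → ∃ (Log₂Below n)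
  log₂Below-inhabited n = _ , 0 , 0 , ℕ.m^n>0 n 1 , refl

  n≤2^n : ∀ n → n ℕ.≤ 2 ℕ.^ n
  n≤2^n zero    = ℕ.z≤n
  n≤2^n (suc n) = ℕ.≤-trans (ℕ.+-mono-≤ (ℕ.m^n>0 2 n) (n≤2^n n))
    (ℕ.+-monoʳ-≤ (2 ℕ.^ n) (ℕ.m≤m+n (2 ℕ.^ n) 0))

  2^-cancel-≤ : ∀ {a b} → 2 ℕ.^ a ℕ.≤ 2 ℕ.^ b → a ℕ.≤ b
  2^-cancel-≤ p = ℕ.≮⇒≥ λ b<a → ℕ.<⇒≱ (ℕ.^-monoʳ-< 2 (ℕ.s<s ℕ.z<s) b<a) p

  log₂Below-bounded : ∀ n → IsUpperBound (Log₂Below n) (fromℕ n)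
  log₂Below-bounded n (a , b , 2^a≤n^b , refl)
    with compare (fromℕ a / fromℕ (suc b)) (fromℕ n)
  ... | tri< lt _ _ = inj₁ lt
  ... | tri≈ _ eq _ = inj₂ eq
  ... | tri> _ _ gt = contradiction
          (subst₂ _<_ (sym (×1-homo-* n (suc b))) cancel (*-monoˡ-< (fromℕ-pos b) gt))
          (fromℕ-≮ a≤n*b)
    where
    open SemiringMult (CommutativeRing.semiring commutativeRing) using (×1-homo-*)

    a≤n*b : a ℕ.≤ n ℕ.* suc b
    a≤n*b = 2^-cancel-≤ (ℕ.≤-trans 2^a≤n^b (ℕ.≤-trans (ℕ.^-monoˡ-≤ (suc b) (n≤2^n n))
      (ℕ.≤-reflexive (ℕ.^-*-assoc 2 n (suc b)))))

    c = fromℕ (suc b)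

    cancel : fromℕ a * c ⁻¹ * c ≡ fromℕ a
    cancel = begin
      fromℕ a * c ⁻¹ * c   ≡⟨ *-assoc _ _ _ ⟩
      fromℕ a * (c ⁻¹ * c) ≡⟨ cong (fromℕ a *_) (*-comm _ _) ⟩
      fromℕ a * (c * c ⁻¹) ≡⟨ cong (fromℕ a *_) (⁻¹-inverseʳ λ c≡0 → <-irrefl (sym c≡0) (fromℕ-pos b)) ⟩
      fromℕ a * 1#         ≡⟨ *-identityʳ _ ⟩
      fromℕ a              ∎
      where open ≡-Reasoning

  log₂ : (n : ℕ) .{{_ : NonZero n}} → ℝ
  log₂ n = proj₁ (supremum (Log₂Below n) (log₂Below-inhabited n) (fromℕ n , log₂Below-bounded n))

module PropertyTesting {r} (𝓡 : RealNumbers r) where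

  open RealArithmetic 𝓡 public

  -- The domain [n] is Fin n. For n = suc m, the index t : Fin m stands for the
  -- step from inject₁ t to suc t.
  record BoundedDerivativeProperty (m : ℕ) : Set r where
    field
      lower upper : Fin m → ℝ
      lower<upper : ∀ t → lower t < upper t

  ⟦_⟧ : ∀ {m} → BoundedDerivativeProperty m → Pred (Fin (suc m) → ℝ) r
  ⟦ P ⟧ g = ∀ t → lower t ≤ g (suc t) - g (inject₁ t) × g (suc t) - g (inject₁ t) ≤ upper t
    where open BoundedDerivativeProperty P

  record Distribution (n : ℕ) : Set r where
    field
      mass        : Fin n → ℝ
      mass-nonNeg : ∀ x → 0# ≤ mass x
      mass-total  : sum mass ≡ 1#

  open Distribution public

  expectation : ∀ {n} → Distribution n → (Fin n → ℝ) → ℝ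
  expectation D h = sum λ x → mass D x * h x

  probability : ∀ {n} → Distribution n → {E : Pred (Fin n) r} → Decidable E → ℝ
  probability D E? = expectation D λ x → if does (E? x) then 1# else 0#

  disagreement : ∀ {n} → Distribution n → (f g : Fin n → ℝ) → ℝ
  disagreement D f g = probability D λ x → ¬? (f x ≟ g x)

  IsDistance : ∀ {n} → Distribution n → Pred (Fin n → ℝ) r → (Fin n → ℝ) → ℝ → Set r
  IsDistance D P f = IsMinimum λ d → ∃[ g ] g ∈ P × d ≡ disagreement D f g

  -- An adaptive randomised algorithm with access to samples from an unknown
  -- distribution on Fin n and to values of an unknown function on Fin n.
  -- A toss is internal randomness, with a distribution known to the algorithm.
  data Algorithm (n : ℕ) : Set r where
    output : Bool → Algorithm n
    toss   : ∀ {k} → Distribution k → (Fin k → Algorithm n) → Algorithm n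
    sample : (Fin n → Algorithm n) → Algorithm n
    query  : Fin n → (ℝ → Algorithm n) → Algorithm n

  outputProbability : ∀ {n} → Distribution n → (Fin n → ℝ) → Bool → Algorithm n → ℝ
  outputProbability D f b (output c)  = if does (b Bool.≟ c) then 1# else 0#
  outputProbability D f b (toss C k)  = expectation C λ i → outputProbability D f b (k i)
  outputProbability D f b (sample k)  = expectation D λ x → outputProbability D f b (k x)
  outputProbability D f b (query x k) = outputProbability D f b (k (f x))

  -- Maximum over all outcomes of the tosses and samples; samples are not
  -- queries.
  queryComplexity : ∀ {n} → (Fin n → ℝ) → Algorithm n → ℕ
  queryComplexity f (output _)  = 0
  queryComplexity f (toss _ k)  = foldr ℕ._⊔_ 0 λ i → queryComplexity f (k i)
  queryComplexity f (sample k)  = foldr ℕ._⊔_ 0 λ x → queryComplexity f (k x)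
  queryComplexity f (query x k) = suc (queryComplexity f (k (f x)))

  Accepts Rejects : ∀ {n} → Distribution n → (Fin n → ℝ) → Algorithm n → Set r
  Accepts D f T = fromℕ 2 / fromℕ 3 < outputProbability D f true  T
  Rejects D f T = fromℕ 2 / fromℕ 3 < outputProbability D f false T

  record IsDistributionFreeTester {n} (P : Pred (Fin n → ℝ) r) (ε : ℝ) (T : Algorithm n) : Set r where
    field
      complete : ∀ D f → f ∈ P → Accepts D f T
      sound    : ∀ D f d → IsDistance D P f d → ε < d → Rejects D f T

{-# OPTIONS --safe #-}

-- Let U and L be the prefix sums of the upper and lower bounds; then f ∈ P iff f - U is antitone
-- and f - L is monotone. A round of the tester samples x, compares f x with f at the points met in
-- a binary search for x, and rejects if some comparison violates the bounds. Any x < y have a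
-- common search point z with x ≤ z ≤ y, so two points that pass are mutually consistent. Hence f
-- agrees on all passing points with some g ∈ P, a pointwise minimum of cones as in McShane's
-- extension theorem, and a round rejects with probability at least the distance of f from P.
-- More than 2/ε rounds suffice, since (1 - p)^k (1 + kp) ≤ 1. With a = ⌊log₂ n⌋ ≥ 1 and ε < 1,
-- at most 3/ε rounds of a + 2 ≤ 8a queries each are made; for n = 1 or ε ≥ 1 no query is needed.

module Submission where

open import Defs
open import Algebra.Bundles using (CommutativeRing)
import Algebra.Construct.NaturalChoice.Max as NaturalMax
import Algebra.Construct.NaturalChoice.Min as NaturalMin
import Algebra.Properties.AbelianGroup as AbelianGroupProperties
import Algebra.Properties.CommutativeMonoid.Sum as CommutativeMonoidSum
import Algebra.Properties.Group as GroupProperties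
import Algebra.Properties.Monoid.Sum as MonoidSum
import Algebra.Properties.Semiring.Exp as SemiringExp
import Algebra.Properties.Semiring.Mult as SemiringMult
import Algebra.Properties.Semiring.Sum as SemiringSum
import Algebra.Solver.Ring.NaturalCoefficients.Default as SemiringSolver
open import Data.Bool.Base using (Bool; true; false; not; if_then_else_)
open import Data.Fin.Base as Fin using (Fin; zero; suc; inject₁; toℕ)
import Data.Fin.Properties as Fin
open import Data.List.Base using (List; []; _∷_; length; map; allFin)
open import Data.List.Membership.Propositional using () renaming (_∈_ to _∈ˡ_)
open import Data.List.Membership.Propositional.Properties using (∈-map⁺; ∈-allFin)
open import Data.List.Properties using (length-map)
open import Data.List.Relation.Unary.All as All using (All; []; _∷_; all?)
open import Data.List.Relation.Unary.Any using (here; there)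
open import Data.Nat.Base as ℕ using (ℕ; zero; suc; s≤s; z≤n)
open import Data.Nat.DivMod using (_mod_; m%n<n; m<n⇒m%n≡m)
import Data.Nat.Properties as ℕ
open import Data.Product.Base using (Σ; _×_; _,_; proj₁; proj₂; ∃-syntax)
open import Data.Sum.Base using (inj₁; inj₂)
open import Data.Vec.Functional using (foldr)
open import Function.Base using (_∘_)
open import Relation.Binary.Bundles using (DecTotalOrder; StrictPartialOrder)
import Relation.Binary.Construct.StrictToNonStrict as StrictToNonStrict
open import Relation.Binary.Core using (Rel)
open import Relation.Binary.Definitions using (Reflexive; Transitive; tri<; tri≈; tri>)
open import Relation.Binary.PropositionalEquality
import Relation.Binary.Reasoning.StrictPartialOrder as StrictReasoning
open import Relation.Binary.Structures using (IsStrictTotalOrder)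
open import Relation.Nullary.Decidable
  using (Dec; yes; no; does; ¬?; _×-dec_; _→-dec_; dec-true; dec-false)
open import Relation.Nullary.Negation using (¬_; contradiction)
open import Relation.Unary using (Pred; Decidable; _∈_)

-- Powers of two, maxima and chains of steps.

-- Supplies the floor of log₂ n: the lower half pays for queries through `log₂`, the upper half
-- makes bisection to depth a + 1 reach single points.
∃-2^-bracket : ∀ n → ∃[ a ] 2 ℕ.^ a ℕ.≤ suc n × suc n ℕ.< 2 ℕ.^ suc a
∃-2^-bracket zero = 0 , s≤s z≤n , s≤s (s≤s z≤n)
∃-2^-bracket (suc n) with ∃-2^-bracket n
... | a , 2^a≤ , <2^1+a with suc (suc n) ℕ.<? 2 ℕ.^ suc a
...   | yes lt = a , ℕ.m≤n⇒m≤1+n 2^a≤ , lt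
...   | no n≮2^1+a = suc a , ℕ.≮⇒≥ n≮2^1+a ,
          ℕ.≤-<-trans <2^1+a (ℕ.^-monoʳ-< 2 (s≤s (s≤s z≤n)) (ℕ.n<1+n (suc a)))

foldr-⊔-lub : ∀ {n b} (h : Fin n → ℕ) → (∀ i → h i ℕ.≤ b) → foldr ℕ._⊔_ 0 h ℕ.≤ b
foldr-⊔-lub {zero}  h h≤b = z≤n
foldr-⊔-lub {suc n} h h≤b = ℕ.⊔-lub (h≤b zero) (foldr-⊔-lub (h ∘ suc) (h≤b ∘ suc))

-- The relation is arbitrary so that the recursion can pass to its shift along `suc`: a path from
-- `zero` is one step followed by a path in the shifted relation.
≤-from-steps : ∀ {r m} (R : Rel (Fin (suc m)) r) → Reflexive R → Transitive R →
               (∀ t → R (inject₁ t) (suc t)) → ∀ {i j} → i Fin.≤ j → R i j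
≤-from-steps R ρ τ step {zero} {zero} _ = ρ
≤-from-steps {m = suc m} R ρ τ step {zero} {suc j} _ =
  τ (step zero) (≤-from-steps (λ i j → R (suc i) (suc j)) ρ τ (step ∘ suc) {zero} {j} z≤n)
≤-from-steps {m = suc m} R ρ τ step {suc i} {suc j} (s≤s i≤j) =
  ≤-from-steps (λ i j → R (suc i) (suc j)) ρ τ (step ∘ suc) i≤j

-- Binary search and its separating points.

-- The midpoints met while bisecting [lo, lo + 2^d) towards x.
separators : ℕ → ℕ → ℕ → List ℕ
separators zero    lo x = []
separators (suc d) lo x with x ℕ.<? lo ℕ.+ 2 ℕ.^ d
... | yes _ = lo ℕ.+ 2 ℕ.^ d ∷ separators d lo x
... | no  _ = lo ℕ.+ 2 ℕ.^ d ∷ separators d (lo ℕ.+ 2 ℕ.^ d) x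

length-separators : ∀ d lo x → length (separators d lo x) ≡ d
length-separators zero    lo x = refl
length-separators (suc d) lo x with x ℕ.<? lo ℕ.+ 2 ℕ.^ d
... | yes _ = cong suc (length-separators d lo x)
... | no  _ = cong suc (length-separators d (lo ℕ.+ 2 ℕ.^ d) x)

-- Both searches meet the same midpoints until one falls between `x` and `y`, and that one is on
-- both lists. It must occur, because at depth 0 the interval holds a single point.
common-separator : ∀ d lo {x y} → lo ℕ.≤ x → x ℕ.< y → y ℕ.< lo ℕ.+ 2 ℕ.^ d →
  ∃[ z ] z ∈ˡ separators d lo x × z ∈ˡ separators d lo y × x ℕ.≤ z × z ℕ.≤ y
common-separator zero lo {x} {y} lo≤x x<y y<lo+1 =
  contradiction (ℕ.≤-trans (s≤s lo≤x) x<y)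
    (ℕ.<⇒≱ (subst (y ℕ.<_) (ℕ.+-comm lo 1) y<lo+1))
common-separator (suc d) lo {x} {y} lo≤x x<y y<hi
  with x ℕ.<? lo ℕ.+ 2 ℕ.^ d | y ℕ.<? lo ℕ.+ 2 ℕ.^ d
... | yes _ | yes y<mid =
  let z , z∈x , z∈y , x≤z , z≤y = common-separator d lo lo≤x x<y y<mid
  in z , there z∈x , there z∈y , x≤z , z≤y
... | yes x<mid | no y≮mid = _ , here refl , here refl , ℕ.<⇒≤ x<mid , ℕ.≮⇒≥ y≮mid
... | no x≮mid | yes y<mid = contradiction (ℕ.<-trans x<y y<mid) x≮mid
... | no x≮mid | no _ =
  let z , z∈x , z∈y , x≤z , z≤y =
        common-separator d (lo ℕ.+ 2 ℕ.^ d) (ℕ.≮⇒≥ x≮mid) x<y (subst (y ℕ.<_) double y<hi)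
  in z , there z∈x , there z∈y , x≤z , z≤y
  where
  double : lo ℕ.+ 2 ℕ.^ suc d ≡ lo ℕ.+ 2 ℕ.^ d ℕ.+ 2 ℕ.^ d
  double = trans (cong (λ w → lo ℕ.+ (2 ℕ.^ d ℕ.+ w)) (ℕ.+-identityʳ _))
    (sym (ℕ.+-assoc lo (2 ℕ.^ d) (2 ℕ.^ d)))

-- Order, arithmetic and the Archimedean property of the reals.

module OrderedField {r} (𝓡 : RealNumbers r) where

  open RealArithmetic 𝓡 public
  open CommutativeRing commutativeRing public
    using (+-comm; +-assoc; +-identityʳ; *-identityˡ; zeroˡ; zeroʳ; distribˡ; distribʳ)
  open GroupProperties (CommutativeRing.+-group commutativeRing) public
    using () renaming (//-rightDividesˡ to x-y+y≡x; //-rightDividesʳ to x+y-y≡x)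
  open AbelianGroupProperties (CommutativeRing.+-abelianGroup commutativeRing) public
    using () renaming (xyx⁻¹≈y to x+y-x≡y)
  open SemiringExp (CommutativeRing.semiring commutativeRing) public
    using (_^_)
  open SemiringMult (CommutativeRing.semiring commutativeRing) public
    using (×1-homo-*)
  open SemiringSolver (CommutativeRing.commutativeSemiring commutativeRing) public
    using (solve; _:=_; _:+_; _:*_)

  ≤-decTotalOrder : DecTotalOrder r r r
  ≤-decTotalOrder = record
    { isDecTotalOrder = StrictToNonStrict.isDecTotalOrder _≡_ _<_ isStrictTotalOrder }

  <-strictPartialOrder : StrictPartialOrder r r r
  <-strictPartialOrder = record
    { isStrictPartialOrder = IsStrictTotalOrder.isStrictPartialOrder isStrictTotalOrder }

  open DecTotalOrder ≤-decTotalOrder public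
    using (_≤?_; totalOrder)
    renaming (refl to ≤-refl; trans to ≤-trans; reflexive to ≤-reflexive; antisym to ≤-antisym)
  open NaturalMin totalOrder public
    using (_⊓_; x⊓y≤x; x⊓y≤y; ⊓-sel; ⊓-glb)
  open NaturalMax totalOrder public
    using (_⊔_; x≤x⊔y; x≤y⊔x; ⊔-sel; ⊔-lub)
  open StrictReasoning <-strictPartialOrder public

  ≮⇒≥ : ∀ {x y} → ¬ x < y → y ≤ x
  ≮⇒≥ {x} {y} x≮y with compare x y
  ... | tri< x<y _ _ = contradiction x<y x≮y
  ... | tri≈ _ x≡y _ = inj₂ (sym x≡y)
  ... | tri> _ _ y<x = inj₁ y<x

  ≰⇒> : ∀ {x y} → ¬ x ≤ y → y < x
  ≰⇒> {x} {y} x≰y with compare x y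
  ... | tri< x<y _ _ = contradiction (inj₁ x<y) x≰y
  ... | tri≈ _ x≡y _ = contradiction (inj₂ x≡y) x≰y
  ... | tri> _ _ y<x = y<x

  ≤⇒≯ : ∀ {x y} → x ≤ y → ¬ y < x
  ≤⇒≯ (inj₁ x<y) y<x = <-irrefl refl (<-trans x<y y<x)
  ≤⇒≯ (inj₂ x≡y) y<x = <-irrefl (sym x≡y) y<x

  +-monoˡ-≤ : ∀ z {x y} → x ≤ y → x + z ≤ y + z
  +-monoˡ-≤ z (inj₁ x<y)  = inj₁ (+-monoˡ-< z x<y)
  +-monoˡ-≤ z (inj₂ refl) = inj₂ refl

  +-monoʳ-≤ : ∀ z {x y} → x ≤ y → z + x ≤ z + y
  +-monoʳ-≤ z x≤y = subst₂ _≤_ (+-comm _ z) (+-comm _ z) (+-monoˡ-≤ z x≤y)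

  +-monoʳ-< : ∀ z {x y} → x < y → z + x < z + y
  +-monoʳ-< z x<y = subst₂ _<_ (+-comm _ z) (+-comm _ z) (+-monoˡ-< z x<y)

  +-mono-≤ : ∀ {w x y z} → w ≤ x → y ≤ z → w + y ≤ x + z
  +-mono-≤ w≤x y≤z = ≤-trans (+-monoˡ-≤ _ w≤x) (+-monoʳ-≤ _ y≤z)

  *-monoˡ-≤ : ∀ {z x y} → 0# ≤ z → x ≤ y → x * z ≤ y * z
  *-monoˡ-≤ (inj₁ 0<z)  (inj₁ x<y)  = inj₁ (*-monoˡ-< 0<z x<y)
  *-monoˡ-≤ (inj₂ refl) (inj₁ _)    = inj₂ (trans (zeroʳ _) (sym (zeroʳ _)))
  *-monoˡ-≤ _           (inj₂ refl) = inj₂ refl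

  *-monoʳ-≤ : ∀ {z x y} → 0# ≤ z → x ≤ y → z * x ≤ z * y
  *-monoʳ-≤ 0≤z x≤y = subst₂ _≤_ (*-comm _ _) (*-comm _ _) (*-monoˡ-≤ 0≤z x≤y)

  *-mono-≤ : ∀ {w x y z} → 0# ≤ w → 0# ≤ z → w ≤ x → y ≤ z → w * y ≤ x * z
  *-mono-≤ 0≤w 0≤z w≤x y≤z = ≤-trans (*-monoʳ-≤ 0≤w y≤z) (*-monoˡ-≤ 0≤z w≤x)

  *-nonNeg : ∀ {x y} → 0# ≤ x → 0# ≤ y → 0# ≤ x * y
  *-nonNeg 0≤x 0≤y = subst (_≤ _) (zeroˡ _) (*-monoˡ-≤ 0≤y 0≤x)

  ^-nonNeg : ∀ {x} → 0# ≤ x → ∀ k → 0# ≤ x ^ k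
  ^-nonNeg 0≤x zero    = inj₁ 0<1
  ^-nonNeg 0≤x (suc k) = *-nonNeg 0≤x (^-nonNeg 0≤x k)

  +-cancelʳ-< : ∀ z {x y} → x + z < y + z → x < y
  +-cancelʳ-< z {x} {y} lt with compare x y
  ... | tri< x<y _ _  = x<y
  ... | tri≈ _ refl _ = contradiction lt (<-irrefl refl)
  ... | tri> _ _ y<x  = contradiction (<-trans lt (+-monoˡ-< z y<x)) (<-irrefl refl)

  *-cancelʳ-< : ∀ {z x y} → 0# < z → x * z < y * z → x < y
  *-cancelʳ-< {z} {x} {y} 0<z lt with compare x y
  ... | tri< x<y _ _  = x<y
  ... | tri≈ _ refl _ = contradiction lt (<-irrefl refl)
  ... | tri> _ _ y<x  = contradiction (<-trans lt (*-monoˡ-< 0<z y<x)) (<-irrefl refl)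

  x≤x+y : ∀ {x y} → 0# ≤ y → x ≤ x + y
  x≤x+y {x} {y} 0≤y = subst (_≤ x + y) (+-identityʳ x) (+-monoʳ-≤ x 0≤y)

  pos⇒≢0 : ∀ {x} → 0# < x → x ≢ 0#
  pos⇒≢0 0<x x≡0 = <-irrefl (sym x≡0) 0<x

  ⁻¹-inverseˡ : ∀ {x} → x ≢ 0# → x ⁻¹ * x ≡ 1#
  ⁻¹-inverseˡ x≢0 = trans (*-comm _ _) (⁻¹-inverseʳ x≢0)

  ⁻¹-pos : ∀ {x} → 0# < x → 0# < x ⁻¹
  ⁻¹-pos {x} 0<x = *-cancelʳ-< 0<x
    (subst₂ _<_ (sym (zeroˡ x)) (sym (⁻¹-inverseˡ (pos⇒≢0 0<x))) 0<1)

  1<⁻¹ : ∀ {x} → 0# < x → x < 1# → 1# < x ⁻¹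
  1<⁻¹ {x} 0<x x<1 = *-cancelʳ-< 0<x
    (subst₂ _<_ (sym (*-identityˡ x)) (sym (⁻¹-inverseˡ (pos⇒≢0 0<x))) x<1)

  ≤-move-ˡ : ∀ {l x y} → x + l ≤ y → l ≤ y - x
  ≤-move-ˡ {l} {x} p = subst (_≤ _) (x+y-x≡y x l) (+-monoˡ-≤ (- x) p)

  ≤-move-ʳ : ∀ {u x y} → y ≤ x + u → y - x ≤ u
  ≤-move-ʳ {u} {x} p = subst (_ ≤_) (x+y-x≡y x u) (+-monoˡ-≤ (- x) p)

  fromℕ-nonNeg : ∀ n → 0# ≤ fromℕ n
  fromℕ-nonNeg zero    = ≤-refl
  fromℕ-nonNeg (suc n) = inj₁ (fromℕ-pos n)

  fromℕ-mono-≤ : ∀ {m n} → m ℕ.≤ n → fromℕ m ≤ fromℕ n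
  fromℕ-mono-≤ m≤n = ≮⇒≥ (fromℕ-≮ m≤n)

  2/3+1/3≡1 : fromℕ 2 / fromℕ 3 + fromℕ 3 ⁻¹ ≡ 1#
  2/3+1/3≡1 = begin-equality
    fromℕ 2 / fromℕ 3 + fromℕ 3 ⁻¹      ≡⟨ cong (fromℕ 2 / fromℕ 3 +_) (*-identityˡ _) ⟨
    fromℕ 2 / fromℕ 3 + 1# * fromℕ 3 ⁻¹ ≡⟨ distribʳ (fromℕ 3 ⁻¹) (fromℕ 2) 1# ⟨
    (fromℕ 2 + 1#) / fromℕ 3            ≡⟨ cong (_/ fromℕ 3) (+-comm (fromℕ 2) 1#) ⟩
    fromℕ 3 / fromℕ 3                   ≡⟨ ⁻¹-inverseʳ (pos⇒≢0 (fromℕ-pos 2)) ⟩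
    1#                                  ∎

  2/3<1 : fromℕ 2 / fromℕ 3 < 1#
  2/3<1 = subst₂ _<_ (+-identityʳ _) 2/3+1/3≡1 (+-monoʳ-< (fromℕ 2 / fromℕ 3) (⁻¹-pos (fromℕ-pos 2)))

  -- Here `y` is the probability of the wrong output. The bound y < 1/3 is taken with its quotient
  -- cleared, the form in which the Bernoulli inequality delivers it.
  2/3<-complement : ∀ {x y} → x + y ≡ 1# → y * fromℕ 3 < 1# → fromℕ 2 / fromℕ 3 < x
  2/3<-complement {x} {y} x+y≡1 3y<1 = +-cancelʳ-< y (begin-strict
    fromℕ 2 / fromℕ 3 + y           <⟨ +-monoʳ-< _ y<1/3 ⟩
    fromℕ 2 / fromℕ 3 + fromℕ 3 ⁻¹  ≡⟨ 2/3+1/3≡1 ⟩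
    1#                              ≡⟨ x+y≡1 ⟨
    x + y                           ∎)
    where
    y<1/3 : y < fromℕ 3 ⁻¹
    y<1/3 = *-cancelʳ-< (fromℕ-pos 2)
      (subst (y * fromℕ 3 <_) (sym (⁻¹-inverseˡ (pos⇒≢0 (fromℕ-pos 2)))) 3y<1)

  -- Without exponentials: (1 - p)^k ≤ (1 + p)^-k ≤ 1 / (1 + kp).
  bernoulli : ∀ {p q} → 0# ≤ p → 0# ≤ q → q + p ≡ 1# → ∀ k → q ^ k * (1# + fromℕ k * p) ≤ 1#
  bernoulli {p} {q} 0≤p 0≤q q+p≡1 zero = ≤-reflexive (begin-equality
    1# * (1# + 0# * p) ≡⟨ *-identityˡ _ ⟩
    1# + 0# * p        ≡⟨ cong (1# +_) (zeroˡ p) ⟩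
    1# + 0#            ≡⟨ +-identityʳ 1# ⟩
    1#                 ∎)
  bernoulli {p} {q} 0≤p 0≤q q+p≡1 (suc k) = begin
    q * q ^ k * (1# + (1# + fromℕ k) * p) ≡⟨ rearrange ⟩
    q ^ k * (q * s + q * p)               ≤⟨ *-monoʳ-≤ (^-nonNeg 0≤q k) (+-monoʳ-≤ (q * s) (*-monoˡ-≤ 0≤p q≤s)) ⟩
    q ^ k * (q * s + s * p)               ≡⟨ cong (λ w → q ^ k * (w + s * p)) (*-comm q s) ⟩
    q ^ k * (s * q + s * p)               ≡⟨ cong (q ^ k *_) (distribˡ s q p) ⟨
    q ^ k * (s * (q + p))                 ≡⟨ cong (λ w → q ^ k * (s * w)) q+p≡1 ⟩
    q ^ k * (s * 1#)                      ≡⟨ cong (q ^ k *_) (*-identityʳ s) ⟩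
    q ^ k * s                             ≤⟨ bernoulli 0≤p 0≤q q+p≡1 k ⟩
    1#                                    ∎
    where
    s = 1# + fromℕ k * p

    q≤s : q ≤ s
    q≤s = ≤-trans (subst (q ≤_) q+p≡1 (x≤x+y 0≤p)) (x≤x+y (*-nonNeg (fromℕ-nonNeg k) 0≤p))

    rearrange : q * q ^ k * (1# + (1# + fromℕ k) * p) ≡ q ^ k * (q * s + q * p)
    rearrange = trans
      (cong (λ w → q * q ^ k * (1# + w)) (trans (distribʳ p 1# (fromℕ k)) (cong (_+ fromℕ k * p) (*-identityˡ p))))
      (solve 5 (λ o q a p c → q :* a :* (o :+ (p :+ c)) := a :* (q :* (o :+ c) :+ q :* p))
        refl 1# q (q ^ k) p (fromℕ k * p))

  -- Completeness yields this. Let s be the supremum of the naturals up to `x`; some such n exceeds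
  -- s - 1, and then n + 1 > s cannot be at most `x`.
  ∃-floor : ∀ {x} → 0# ≤ x → ∃[ n ] fromℕ n ≤ x × x < fromℕ (suc n)
  ∃-floor {x} 0≤x
    with supremum (λ y → ∃[ n ] y ≡ fromℕ n × y ≤ x) (0# , 0 , refl , 0≤x) (x , λ (_ , _ , y≤x) → y≤x)
  ... | s , bound , approach with approach {s - 1#} s-1<s
    where
    s-1<s : s - 1# < s
    s-1<s = subst₂ _<_ (+-identityʳ _) (x-y+y≡x 1# s) (+-monoʳ-< (s - 1#) 0<1)
  ... | _ , (n , refl , n≤x) , s-1<n with compare x (fromℕ (suc n))
  ...   | tri< x<1+n _ _ = n , n≤x , x<1+n
  ...   | tri≈ _ x≡1+n _ = contradiction s<1+n (≤⇒≯ (bound (suc n , refl , inj₂ (sym x≡1+n))))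
    where s<1+n = subst₂ _<_ (x-y+y≡x 1# s) (+-comm _ 1#) (+-monoˡ-< 1# s-1<n)
  ...   | tri> _ _ 1+n<x = contradiction s<1+n (≤⇒≯ (bound (suc n , refl , inj₁ 1+n<x)))
    where s<1+n = subst₂ _<_ (x-y+y≡x 1# s) (+-comm _ 1#) (+-monoˡ-< 1# s-1<n)

  -- `log₂` is an upper bound of its defining set of quotients, and `a` is the quotient with
  -- denominator 1, which the set encodes as 0.
  fromℕ≤log₂ : ∀ a {n} → 2 ℕ.^ a ℕ.≤ suc n → fromℕ a ≤ log₂ (suc n)
  fromℕ≤log₂ a {n} 2^a≤n = proj₁ (proj₂ (supremum (Log₂Below (suc n)) _ _))
    (a , 0 , subst (2 ℕ.^ a ℕ.≤_) (sym (ℕ.^-identityʳ (suc n))) 2^a≤n , a≡a/1)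
    where
    a≡a/1 : fromℕ a ≡ fromℕ a / fromℕ 1
    a≡a/1 = begin-equality
      fromℕ a                         ≡⟨ *-identityʳ _ ⟨
      fromℕ a * 1#                    ≡⟨ cong (fromℕ a *_) (⁻¹-inverseʳ (pos⇒≢0 (fromℕ-pos 0))) ⟨
      fromℕ a * (fromℕ 1 * fromℕ 1 ⁻¹) ≡⟨ cong (λ w → fromℕ a * (w * fromℕ 1 ⁻¹)) (+-identityʳ 1#) ⟩
      fromℕ a * (1# * fromℕ 1 ⁻¹)     ≡⟨ cong (fromℕ a *_) (*-identityˡ _) ⟩
      fromℕ a / fromℕ 1               ∎

-- Finite expectations, probabilities and outputs of algorithms.

module Expectation {r} (𝓡 : RealNumbers r) where

  open PropertyTesting 𝓡 public
    using (Distribution; mass; mass-nonNeg; mass-total; expectation; probability; disagreement;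
           Algorithm; output; toss; sample; query; outputProbability)
  open OrderedField 𝓡 public
  open CommutativeMonoidSum (CommutativeRing.+-commutativeMonoid commutativeRing)
    using (∑-distrib-+)
  open MonoidSum (CommutativeRing.+-monoid commutativeRing)
    using (sum-cong-≗)
  open SemiringSum (CommutativeRing.semiring commutativeRing)
    using (*-distribʳ-sum)

  sum-mono : ∀ {n} {h h′ : Fin n → ℝ} → (∀ x → h x ≤ h′ x) → sum h ≤ sum h′
  sum-mono {zero}  h≤h′ = ≤-refl
  sum-mono {suc n} h≤h′ = +-mono-≤ (h≤h′ zero) (sum-mono (h≤h′ ∘ suc))

  indicator : Bool → ℝ
  indicator b = if b then 1# else 0#

  module _ {n} (D : Distribution n) where

    expectation-cong : ∀ {h h′} → (∀ x → h x ≡ h′ x) → expectation D h ≡ expectation D h′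
    expectation-cong h≗h′ = sum-cong-≗ λ x → cong (mass D x *_) (h≗h′ x)

    expectation-mono : ∀ {h h′} → (∀ x → h x ≤ h′ x) → expectation D h ≤ expectation D h′
    expectation-mono h≤h′ = sum-mono λ x → *-monoʳ-≤ (mass-nonNeg D x) (h≤h′ x)

    expectation-+ : ∀ h h′ → expectation D (λ x → h x + h′ x) ≡ expectation D h + expectation D h′
    expectation-+ h h′ = trans (sum-cong-≗ λ x → distribˡ (mass D x) (h x) (h′ x))
      (∑-distrib-+ (λ x → mass D x * h x) (λ x → mass D x * h′ x))

    expectation-*ʳ : ∀ h c → expectation D (λ x → h x * c) ≡ expectation D h * c
    expectation-*ʳ h c = trans (sum-cong-≗ λ x → sym (*-assoc (mass D x) (h x) c))
      (sym (*-distribʳ-sum c λ x → mass D x * h x))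

    expectation-const : ∀ c → expectation D (λ _ → c) ≡ c
    expectation-const c = begin-equality
      sum (λ x → mass D x * c) ≡⟨ *-distribʳ-sum c (mass D) ⟨
      sum (mass D) * c         ≡⟨ cong (_* c) (mass-total D) ⟩
      1# * c                   ≡⟨ *-identityˡ c ⟩
      c                        ∎

    module _ {E : Pred (Fin n) r} (E? : Decidable E) where

      probability-≤ : ∀ {F : Pred (Fin n) r} (F? : Decidable F) → (∀ {x} → E x → F x) →
                      probability D E? ≤ probability D F?
      probability-≤ F? E⊆F = expectation-mono ≤-pointwise
        where
        ≤-pointwise : ∀ x → indicator (does (E? x)) ≤ indicator (does (F? x))
        ≤-pointwise x with E? x | F? x
        ... | yes _  | yes _ = ≤-refl
        ... | yes ex | no ¬f = contradiction (E⊆F ex) ¬f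
        ... | no _   | yes _ = inj₁ 0<1
        ... | no _   | no _  = ≤-refl

      probability-certain : (∀ x → E x) → probability D E? ≡ 1#
      probability-certain e = trans
        (expectation-cong λ x → cong indicator (dec-true (E? x) (e x)))
        (expectation-const 1#)

      probability-impossible : (∀ x → ¬ E x) → probability D E? ≡ 0#
      probability-impossible ¬e = trans
        (expectation-cong λ x → cong indicator (dec-false (E? x) (¬e x)))
        (expectation-const 0#)

      probability-nonNeg : 0# ≤ probability D E?
      probability-nonNeg = subst (_≤ probability D E?) (expectation-const 0#)
        (expectation-mono λ x → 0≤indicator (does (E? x)))
        where
        0≤indicator : ∀ b → 0# ≤ indicator b
        0≤indicator true  = inj₁ 0<1
        0≤indicator false = ≤-refl

      probability-∁ : probability D E? + probability D (λ x → ¬? (E? x)) ≡ 1#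
      probability-∁ = begin-equality
        probability D E? + probability D (λ x → ¬? (E? x))
          ≡⟨ expectation-+ (λ x → indicator (does (E? x))) (λ x → indicator (not (does (E? x)))) ⟨
        expectation D (λ x → indicator (does (E? x)) + indicator (not (does (E? x))))
          ≡⟨ expectation-cong (λ x → indicator-not (does (E? x))) ⟩
        expectation D (λ _ → 1#)
          ≡⟨ expectation-const 1# ⟩
        1# ∎
        where
        indicator-not : ∀ b → indicator b + indicator (not b) ≡ 1#
        indicator-not true  = +-identityʳ 1#
        indicator-not false = +-identityˡ 1#

      -- The shape of one round: `c` is the acceptance probability of the remaining rounds, which
      -- does not depend on the point sampled now. This is why the rounds multiply.
      expectation-if : ∀ c → expectation D (λ x → if does (E? x) then c else 0#) ≡ probability D E? * c
      expectation-if c = trans (expectation-cong λ x → if-* (does (E? x)))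
        (expectation-*ʳ (λ x → indicator (does (E? x))) c)
        where
        if-* : ∀ b → (if b then c else 0#) ≡ indicator b * c
        if-* true  = sym (*-identityˡ c)
        if-* false = sym (zeroˡ c)

  -- Lets rejection be bounded through acceptance, for which there is a product formula.
  output-total : ∀ {n} (D : Distribution n) f (T : Algorithm n) →
                 outputProbability D f false T + outputProbability D f true T ≡ 1#
  output-total D f (output true)  = +-identityˡ 1#
  output-total D f (output false) = +-identityʳ 1#
  output-total D f (toss C k)     = trans (sym (expectation-+ C _ _))
    (trans (expectation-cong C λ i → output-total D f (k i)) (expectation-const C 1#))
  output-total D f (sample k)     = trans (sym (expectation-+ D _ _))
    (trans (expectation-cong D λ x → output-total D f (k x)) (expectation-const D 1#))
  output-total D f (query x k)    = output-total D f (k (f x))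

-- Bounded-derivative properties and their lattice structure.

module BoundedDerivative {r} (𝓡 : RealNumbers r) where

  open PropertyTesting 𝓡 public
    using (BoundedDerivativeProperty; ⟦_⟧)
  open OrderedField 𝓡

  prefixSum : ∀ {m} → (Fin m → ℝ) → Fin (suc m) → ℝ
  prefixSum         s zero    = 0#
  prefixSum {suc m} s (suc i) = s zero + prefixSum (s ∘ suc) i

  prefixSum-step : ∀ {m} (s : Fin m → ℝ) t → prefixSum s (suc t) ≡ prefixSum s (inject₁ t) + s t
  prefixSum-step s zero    = +-comm (s zero) 0#
  prefixSum-step s (suc t) = trans (cong (s zero +_) (prefixSum-step (s ∘ suc) t))
    (sym (+-assoc (s zero) _ _))

  module Potentials {m} (P : BoundedDerivativeProperty m) where

    open BoundedDerivativeProperty P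

    L U : Fin (suc m) → ℝ
    L = prefixSum lower
    U = prefixSum upper

    -- Membership with the subtraction cleared, so that minima and maxima can be treated by
    -- monotonicity of addition alone.
    Steps : Pred (Fin (suc m) → ℝ) r
    Steps g = ∀ t → g (inject₁ t) + lower t ≤ g (suc t) × g (suc t) ≤ g (inject₁ t) + upper t

    Steps⇒∈ : ∀ g → Steps g → g ∈ ⟦ P ⟧
    Steps⇒∈ g steps t = let lo , hi = steps t in ≤-move-ˡ lo , ≤-move-ʳ hi

    ∈⇒Steps : ∀ g → g ∈ ⟦ P ⟧ → Steps g
    ∈⇒Steps g g∈P t =
      let lo , hi = g∈P t in
      subst₂ _≤_ (+-comm _ _) (x-y+y≡x x y) (+-monoˡ-≤ x lo) ,
      subst₂ _≤_ (x-y+y≡x x y) (+-comm _ _) (+-monoˡ-≤ x hi)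
      where
      x = g (inject₁ t)
      y = g (suc t)

    -- For i ≤ j, this says L j - L i ≤ w - v ≤ U j - U i. Membership in P means that f - U is
    -- antitone and f - L monotone; in this form transitivity is immediate.
    Ascent : Fin (suc m) → ℝ → Fin (suc m) → ℝ → Set r
    Ascent i v j w = w - U j ≤ v - U i × v - L i ≤ w - L j

    ascent? : ∀ i v j w → Dec (Ascent i v j w)
    ascent? i v j w = (w - U j ≤? v - U i) ×-dec (v - L i ≤? w - L j)

    Ascent-refl : ∀ i {v} → Ascent i v i v
    Ascent-refl _ = ≤-refl , ≤-refl

    Ascent-trans : ∀ i j k {u v w} → Ascent i u j v → Ascent j v k w → Ascent i u k w
    Ascent-trans _ _ _ (a , b) (a′ , b′) = ≤-trans a′ a , ≤-trans b b′

    -- By transitivity single steps suffice: on each, f rises by at most the increment of `U` and at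
    -- least that of `L`.
    ∈⇒Ascent : ∀ {f} → f ∈ ⟦ P ⟧ → ∀ {i j} → i Fin.≤ j → Ascent i (f i) j (f j)
    ∈⇒Ascent {f} f∈P = ≤-from-steps (λ i j → Ascent i (f i) j (f j))
      (λ {i} → Ascent-refl i) (λ {i} {j} {k} → Ascent-trans i j k) step
      where
      shift : ∀ x y s → x + s - (y + s) ≡ x - y
      shift x y s = begin-equality
        x + s - (y + s)                 ≡⟨ cong (λ w → w + s - (y + s)) (x-y+y≡x y x) ⟨
        (x - y + y) + s - (y + s)       ≡⟨ cong (_- (y + s)) (+-assoc (x - y) y s) ⟩
        (x - y) + (y + s) - (y + s)     ≡⟨ x+y-y≡x (y + s) (x - y) ⟩
        x - y                           ∎

      step : ∀ t → Ascent (inject₁ t) (f (inject₁ t)) (suc t) (f (suc t))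
      step t with ∈⇒Steps f f∈P t
      ... | lo , hi rewrite prefixSum-step upper t | prefixSum-step lower t =
        subst (f (suc t) - (U (inject₁ t) + upper t) ≤_) (shift _ _ (upper t)) (+-monoˡ-≤ _ hi) ,
        subst (_≤ f (suc t) - (L (inject₁ t) + lower t)) (shift _ _ (lower t)) (+-monoˡ-≤ _ lo)

    lower≤upper : ∀ t → lower t ≤ upper t
    lower≤upper t = inj₁ (lower<upper t)

    -- Applied with `upper` and with `lower` as increments, this gives the two branches of a cone.
    Steps-potential : ∀ s → (∀ t → lower t ≤ s t × s t ≤ upper t) → ∀ c → Steps (λ y → c + prefixSum s y)
    Steps-potential s bounds c t with bounds t
    ... | lo , hi rewrite prefixSum-step s t | sym (+-assoc c (prefixSum s (inject₁ t)) (s t)) =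
      +-monoʳ-≤ _ lo , +-monoʳ-≤ _ hi

    -- The lower bound holds for each function separately. For the upper bound, the function
    -- attaining the minimum at `inject₁ t` is already low enough at `suc t`.
    Steps-⊓ : ∀ g h → Steps g → Steps h → Steps (λ y → g y ⊓ h y)
    Steps-⊓ g h sg sh t = lo , hi
      where
      x = inject₁ t
      lo : g x ⊓ h x + lower t ≤ g (suc t) ⊓ h (suc t)
      lo = ⊓-glb (≤-trans (+-monoˡ-≤ _ (x⊓y≤x _ _)) (proj₁ (sg t)))
                 (≤-trans (+-monoˡ-≤ _ (x⊓y≤y _ _)) (proj₁ (sh t)))
      hi : g (suc t) ⊓ h (suc t) ≤ g x ⊓ h x + upper t
      hi with ⊓-sel (g x) (h x)
      ... | inj₁ eq rewrite eq = ≤-trans (x⊓y≤x _ _) (proj₂ (sg t))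
      ... | inj₂ eq rewrite eq = ≤-trans (x⊓y≤y _ _) (proj₂ (sh t))

    -- Dual to the minimum: now the lower bound follows the function attaining the maximum.
    Steps-⊔ : ∀ g h → Steps g → Steps h → Steps (λ y → g y ⊔ h y)
    Steps-⊔ g h sg sh t = lo , hi
      where
      x = inject₁ t
      lo : g x ⊔ h x + lower t ≤ g (suc t) ⊔ h (suc t)
      lo with ⊔-sel (g x) (h x)
      ... | inj₁ eq rewrite eq = ≤-trans (proj₁ (sg t)) (x≤x⊔y _ _)
      ... | inj₂ eq rewrite eq = ≤-trans (proj₁ (sh t)) (x≤y⊔x _ _)
      hi : g (suc t) ⊔ h (suc t) ≤ g x ⊔ h x + upper t
      hi = ⊔-lub (≤-trans (proj₂ (sg t)) (+-monoˡ-≤ _ (x≤x⊔y _ _)))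
                 (≤-trans (proj₂ (sh t)) (+-monoˡ-≤ _ (x≤y⊔x _ _)))

    -- Extension from a consistent set of points.

    module Extension (f : Fin (suc m) → ℝ) {G : Pred (Fin (suc m)) r} (G? : Decidable G)
      (consistent : ∀ {x y} → G x → G y → x Fin.≤ y → Ascent x (f x) y (f y)) where

      -- The largest g ∈ P with g x = f x: to the right of x the first branch is the larger one,
      -- to the left the second.
      cone : Fin (suc m) → Fin (suc m) → ℝ
      cone x y = (f x - U x + U y) ⊔ (f x - L x + L y)

      Steps-cone : ∀ x → Steps (cone x)
      Steps-cone x = Steps-⊔ (λ y → f x - U x + U y) (λ y → f x - L x + L y)
        (Steps-potential upper (λ t → lower≤upper t , ≤-refl) (f x - U x))
        (Steps-potential lower (λ t → ≤-refl , lower≤upper t) (f x - L x))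

      cone-apex : ∀ x → cone x x ≤ f x
      cone-apex x = ⊔-lub (≤-reflexive (x-y+y≡x (U x) (f x))) (≤-reflexive (x-y+y≡x (L x) (f x)))

      -- To the right of `x` the antitone f - U bounds f by the first branch; to the left the
      -- monotone f - L bounds it by the second.
      f≤cone : ∀ {x y} → G x → G y → f y ≤ cone x y
      f≤cone {x} {y} gx gy with Fin.≤-total x y
      ... | inj₁ x≤y = ≤-trans
        (subst (_≤ f x - U x + U y) (x-y+y≡x (U y) (f y)) (+-monoˡ-≤ (U y) (proj₁ (consistent gx gy x≤y)))) (x≤x⊔y _ _)
      ... | inj₂ y≤x = ≤-trans
        (subst (_≤ f x - L x + L y) (x-y+y≡x (L y) (f y)) (+-monoˡ-≤ (L y) (proj₂ (consistent gy gx y≤x)))) (x≤y⊔x _ _)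

      majorant : ∃[ g ] Steps g × (∀ {y} → G y → f y ≤ g y)
      majorant with Fin.any? G?
      ... | yes (x , gx) = cone x , Steps-cone x , f≤cone gx
      -- With no point in `G` the bound is vacuous, and any member of the property serves.
      ... | no ¬g        = cone zero , Steps-cone zero , λ gy → contradiction (_ , gy) ¬g

      -- The minimum of cones is built one point at a time. Each cone dominates f on `G`, so the
      -- lower bound survives; its apex forces equality at the new point, and later minima can only
      -- lower g at earlier ones.
      interpolant : ∀ xs → ∃[ g ] Steps g × (∀ {y} → G y → f y ≤ g y) × All (λ y → G y → g y ≤ f y) xs
      interpolant [] = let g , steps , f≤g = majorant in g , steps , f≤g , []
      interpolant (x ∷ xs) with interpolant xs | G? x
      ... | g , steps , f≤g , g≤f | yes gx =
        (λ y → g y ⊓ cone x y) , Steps-⊓ g (cone x) steps (Steps-cone x) ,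
        (λ gy → ⊓-glb (f≤g gy) (f≤cone gx gy)) ,
        (λ _ → ≤-trans (x⊓y≤y _ _) (cone-apex x)) ∷ All.map (λ le gy → ≤-trans (x⊓y≤x _ _) (le gy)) g≤f
      ... | g , steps , f≤g , g≤f | no ¬gx = g , steps , f≤g , (λ gx → contradiction gx ¬gx) ∷ g≤f

      extension : ∃[ g ] g ∈ ⟦ P ⟧ × (∀ {y} → G y → g y ≡ f y)
      extension = let g , steps , f≤g , g≤f = interpolant (allFin _) in
        g , Steps⇒∈ g steps , λ {y} gy → ≤-antisym (All.lookup g≤f (∈-allFin y) gy) (f≤g gy)

-- The tester: query count, acceptance probability and correctness.

module BisectionTester {r} (𝓡 : RealNumbers r) where

  open PropertyTesting 𝓡 public
    using (IsDistance; IsDistributionFreeTester; queryComplexity)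
  open Expectation 𝓡 public
  open BoundedDerivative 𝓡 public

  1^ : ∀ k → 1# ^ k ≡ 1#
  1^ zero    = refl
  1^ (suc k) = trans (*-identityˡ _) (1^ k)

  module _ {m} (P : BoundedDerivativeProperty m) where

    open Potentials P

    -- A search point may lie on either side of the sample, so each direction is conditional on the
    -- order.
    Consistent : Fin (suc m) → ℝ → Fin (suc m) → ℝ → Set r
    Consistent i v j w = (i Fin.≤ j → Ascent i v j w) × (j Fin.≤ i → Ascent j w i v)

    consistent? : ∀ i v j w → Dec (Consistent i v j w)
    consistent? i v j w = (i Fin.≤? j →-dec ascent? i v j w) ×-dec (j Fin.≤? i →-dec ascent? j w i v)

    -- Separators beyond m wrap around to arbitrary points; common-separator never needs them.
    ancestors : ℕ → Fin (suc m) → List (Fin (suc m))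
    ancestors d x = map (_mod suc m) (separators d 0 (toℕ x))

    check : Fin (suc m) → ℝ → List (Fin (suc m)) → Algorithm (suc m) → Algorithm (suc m)
    check x v []       next = next
    check x v (z ∷ zs) next = query z λ w →
      if does (consistent? x v z w) then check x v zs next else output false

    -- `d` is the depth of the bisection and `k` the number of rounds.
    tester : ℕ → ℕ → Algorithm (suc m)
    tester d zero    = output true
    tester d (suc k) = sample λ x → query x λ v → check x v (ancestors d x) (tester d k)

    module _ (f : Fin (suc m) → ℝ) where

      length-check : ∀ x v zs next →
        queryComplexity f (check x v zs next) ℕ.≤ length zs ℕ.+ queryComplexity f next
      length-check x v []       next = ℕ.≤-refl
      length-check x v (z ∷ zs) next with does (consistent? x v z (f z))
      ... | true  = s≤s (length-check x v zs next)
      ... | false = s≤s z≤n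

      -- A round queries the sample and one point per level of the bisection, and a failed
      -- comparison only cuts it short.
      queryComplexity-tester : ∀ d k → queryComplexity f (tester d k) ℕ.≤ k ℕ.* suc d
      queryComplexity-tester d zero    = z≤n
      queryComplexity-tester d (suc k) =
        foldr-⊔-lub (λ x → suc (queryComplexity f (check x (f x) (ancestors d x) (tester d k)))) λ x →
          s≤s (ℕ.≤-trans (length-check x (f x) (ancestors d x) (tester d k))
            (ℕ.+-mono-≤ (ℕ.≤-reflexive (length-ancestors x)) (queryComplexity-tester d k)))
        where
        length-ancestors : ∀ x → length (ancestors d x) ≡ d
        length-ancestors x = trans (length-map _ (separators d 0 (toℕ x))) (length-separators d 0 (toℕ x))

      Passes : ℕ → Pred (Fin (suc m)) r
      Passes d x = All (λ z → Consistent x (f x) z (f z)) (ancestors d x)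

      passes? : ∀ d → Decidable (Passes d)
      passes? d x = all? (λ z → consistent? x (f x) z (f z)) (ancestors d x)

      -- The comparisons of `x` and of `y` with a common search point between them compose by
      -- transitivity; n ≤ 2^d keeps `y` inside the bisected interval.
      Passes⇒Ascent : ∀ d → suc m ℕ.≤ 2 ℕ.^ d → ∀ {x y} → Passes d x → Passes d y →
                      x Fin.≤ y → Ascent x (f x) y (f y)
      Passes⇒Ascent d n≤2^d {x} {y} px py x≤y with ℕ.m≤n⇒m<n∨m≡n x≤y
      ... | inj₂ x≡y rewrite Fin.toℕ-injective {i = x} {j = y} x≡y = Ascent-refl y
      ... | inj₁ x<y with common-separator d 0 z≤n x<y (ℕ.<-≤-trans (Fin.toℕ<n y) n≤2^d)
      ...   | z , z∈x , z∈y , x≤z , z≤y =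
        Ascent-trans x (z mod suc m) y
          (proj₁ (All.lookup px (∈-map⁺ _ z∈x)) (subst (toℕ x ℕ.≤_) (sym z≡) x≤z))
          (proj₂ (All.lookup py (∈-map⁺ _ z∈y)) (subst (ℕ._≤ toℕ y) (sym z≡) z≤y))
        where
        -- As z ≤ y < n, the wrap-around in `ancestors` leaves z unchanged.
        z≡ : toℕ (z mod suc m) ≡ z
        z≡ = trans (Fin.toℕ-fromℕ< (m%n<n z (suc m)))
          (m<n⇒m%n≡m (ℕ.≤-<-trans z≤y (Fin.toℕ<n y)))

      ∈⇒Passes : f ∈ ⟦ P ⟧ → ∀ d x → Passes d x
      ∈⇒Passes f∈P d x = All.universal (λ _ → ∈⇒Ascent f∈P , ∈⇒Ascent f∈P) (ancestors d x)

      module _ (D : Distribution (suc m)) where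

        -- `check` branches on the decisions that `all?` combines, in the same order.
        accept-check : ∀ x zs next → outputProbability D f true (check x (f x) zs next) ≡
          (if does (all? (λ z → consistent? x (f x) z (f z)) zs) then outputProbability D f true next else 0#)
        accept-check x []       next = refl
        accept-check x (z ∷ zs) next with does (consistent? x (f x) z (f z))
        ... | true  = accept-check x zs next
        ... | false = refl

        accept-tester : ∀ d k → outputProbability D f true (tester d k) ≡ probability D (passes? d) ^ k
        accept-tester d zero    = refl
        accept-tester d (suc k) = trans
          (expectation-cong D λ x → accept-check x (ancestors d x) (tester d k))
          (trans (expectation-if D (passes? d) _) (cong (probability D (passes? d) *_) (accept-tester d k)))

        -- The points that pass are mutually consistent, so f restricted to them extends to some g
        -- in the property; f and g can differ only where the check fails.
        distance≤failure : ∀ d {δ} → suc m ℕ.≤ 2 ℕ.^ d → IsDistance D ⟦ P ⟧ f δ →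
                           δ ≤ probability D (λ x → ¬? (passes? d x))
        distance≤failure d n≤2^d (_ , minimal) =
          let g , g∈P , g≡f = extension in
          ≤-trans (minimal (g , g∈P , refl))
            (probability-≤ D (λ x → ¬? (f x ≟ g x)) (λ x → ¬? (passes? d x))
              λ f≢g px → f≢g (sym (g≡f px)))
          where open Extension f (passes? d) (Passes⇒Ascent d n≤2^d)

    tester-correct : ∀ {d k ε} → 0# < ε → suc m ℕ.≤ 2 ℕ.^ d → fromℕ 2 < fromℕ k * ε →
                     IsDistributionFreeTester ⟦ P ⟧ ε (tester d k)
    tester-correct {d} {k} {ε} 0<ε n≤2^d 2<kε = record
      { complete = λ D f f∈P → subst (fromℕ 2 / fromℕ 3 <_) (sym (begin-equality
          outputProbability D f true (tester d k) ≡⟨ accept-tester f D d k ⟩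
          probability D (passes? f d) ^ k         ≡⟨ cong (_^ k) (probability-certain D (passes? f d) (∈⇒Passes f f∈P d)) ⟩
          1# ^ k                                  ≡⟨ 1^ k ⟩
          1#                                      ∎)) 2/3<1
      -- The wrong output has probability q^k, with q the probability that a point passes; the
      -- failure probability 1 - q is at least the distance, hence at least ε.
      ; sound    = λ D f δ dist ε<δ → 2/3<-complement (output-total D f (tester d k))
          (subst (λ a → a * fromℕ 3 < 1#) (sym (accept-tester f D d k))
            (power-small
              (probability-nonNeg D (passes? f d))
              (probability-∁ D (passes? f d))
              (≤-trans (inj₁ ε<δ) (distance≤failure f D d n≤2^d dist))))
      }
      where
      -- Since kp ≥ kε > 2, Bernoulli gives 3q^k < q^k (1 + kp) ≤ 1. The strict step multiplies by
      -- q^k > 0, so q^k = 0 is a separate case.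
      power-small : ∀ {p q} → 0# ≤ q → q + p ≡ 1# → ε ≤ p → q ^ k * fromℕ 3 < 1#
      power-small {p} {q} 0≤q q+p≡1 ε≤p with ^-nonNeg 0≤q k
      ... | inj₂ 0≡q^k = subst (_< 1#) (trans (sym (zeroˡ _)) (cong (_* fromℕ 3) 0≡q^k)) 0<1
      ... | inj₁ 0<q^k = begin-strict
        q ^ k * fromℕ 3              ≡⟨ *-comm _ _ ⟩
        fromℕ 3 * q ^ k              <⟨ *-monoˡ-< 0<q^k (+-monoʳ-< 1# 2<kε) ⟩
        (1# + fromℕ k * ε) * q ^ k   ≡⟨ *-comm _ _ ⟩
        q ^ k * (1# + fromℕ k * ε)   ≤⟨ *-monoʳ-≤ (inj₁ 0<q^k) (+-monoʳ-≤ 1# (*-monoʳ-≤ (fromℕ-nonNeg k) ε≤p)) ⟩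
        q ^ k * (1# + fromℕ k * p)   ≤⟨ bernoulli (≤-trans (inj₁ 0<ε) ε≤p) 0≤q q+p≡1 k ⟩
        1#                           ∎

    -- Soundness is vacuous when no distance exceeds ε. This settles n = 1 and ε ≥ 1.
    constant-correct : ∀ {ε} → (∀ D f δ → IsDistance D ⟦ P ⟧ f δ → δ ≤ ε) →
                       IsDistributionFreeTester ⟦ P ⟧ ε (output true)
    constant-correct δ≤ε = record
      { complete = λ _ _ _ → 2/3<1
      ; sound    = λ D f δ dist ε<δ → contradiction ε<δ (≤⇒≯ (δ≤ε D f δ dist))
      }

    distance≤1 : ∀ D f δ → IsDistance D ⟦ P ⟧ f δ → δ ≤ 1#
    distance≤1 D f δ ((g , _ , refl) , _) =
      subst (disagreement D f g ≤_) (probability-∁ D f≢g?)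
        (x≤x+y (probability-nonNeg D λ x → ¬? (f≢g? x)))
      where f≢g? = λ x → ¬? (f x ≟ g x)

  -- Degenerate cases and the query budget.

  -- On one point there is no step to constrain, so f itself is in the property.
  distance-singleton : ∀ (P : BoundedDerivativeProperty 0) D f δ → IsDistance D ⟦ P ⟧ f δ → δ ≤ 0#
  distance-singleton P D f δ (_ , minimal) =
    subst (δ ≤_) (probability-impossible D (λ x → ¬? (f x ≟ f x)) λ _ f≢f → f≢f refl)
      (minimal (f , (λ ()) , refl))

  budget-nonNeg : ∀ {ε} n → 0# < ε → 0# ≤ fromℕ 24 * ε ⁻¹ * log₂ (suc n)
  budget-nonNeg n 0<ε = *-nonNeg (*-nonNeg (fromℕ-nonNeg 24) (inj₁ (⁻¹-pos 0<ε))) (fromℕ≤log₂ 0 (s≤s z≤n))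

  -- Rounding 2/ε up costs one extra round, which 1/ε > 1 absorbs.
  rounds≤3/ε : ∀ j {ε} → 0# < ε → ε < 1# → fromℕ j ≤ fromℕ 2 * ε ⁻¹ → fromℕ (suc j) ≤ fromℕ 3 * ε ⁻¹
  rounds≤3/ε j {ε} 0<ε ε<1 j≤2/ε = begin
    1# + fromℕ j                ≤⟨ +-mono-≤ (inj₁ (1<⁻¹ 0<ε ε<1)) j≤2/ε ⟩
    ε ⁻¹ + fromℕ 2 * ε ⁻¹       ≡⟨ cong (_+ fromℕ 2 * ε ⁻¹) (*-identityˡ (ε ⁻¹)) ⟨
    1# * ε ⁻¹ + fromℕ 2 * ε ⁻¹  ≡⟨ distribʳ (ε ⁻¹) 1# (fromℕ 2) ⟨
    fromℕ 3 * ε ⁻¹              ∎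

  -- With `suc a` the floor of log₂ n, the left side is the cost of a round: depth `suc a` + 1, and
  -- one query for the sample. The factor 8 is 24 divided by the 3 of the round count.
  2+n≤8*n : ∀ a → 2 ℕ.+ suc a ℕ.≤ 8 ℕ.* suc a
  2+n≤8*n a = ℕ.≤-trans (ℕ.≤-reflexive (ℕ.+-comm 2 (suc a)))
    (ℕ.+-monoʳ-≤ (suc a) (ℕ.≤-trans (s≤s (s≤s z≤n)) (ℕ.m≤m*n 7 (suc a))))

  bisection-tester : ∀ m (P : BoundedDerivativeProperty m) ε → 0# < ε →
    Σ (Algorithm (suc m)) λ T →
    IsDistributionFreeTester ⟦ P ⟧ ε T ×
    (∀ (f : Fin (suc m) → ℝ) → fromℕ (queryComplexity f T) ≤ fromℕ 24 * ε ⁻¹ * log₂ (suc m))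
  bisection-tester zero P ε 0<ε = output true ,
    constant-correct P (λ D f δ dist → ≤-trans (distance-singleton P D f δ dist) (inj₁ 0<ε)) ,
    λ _ → budget-nonNeg 0 0<ε
  bisection-tester (suc m) P ε 0<ε with 1# ≤? ε
  ... | yes 1≤ε = output true ,
    constant-correct P (λ D f δ dist → ≤-trans (distance≤1 P D f δ dist) 1≤ε) ,
    λ _ → budget-nonNeg (suc m) 0<ε
  ... | no 1≰ε with ∃-2^-bracket (suc m) | ∃-floor (*-nonNeg (fromℕ-nonNeg 2) (inj₁ (⁻¹-pos 0<ε)))
  -- The exponent 0 would force n < 2, but n is at least 2 here.
  ...   | zero , _ , s≤s (s≤s ()) | _
  ...   | suc a , 2^a≤n , n<2^d | j , j≤2/ε , 2/ε<k =
    tester P d k , tester-correct P {d} {k} 0<ε (ℕ.<⇒≤ n<2^d) 2<kε , complexity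
    where
    -- The upper half of the bracket, n < 2^d, fixes the depth. `k` is one more than the floor of
    -- 2/ε, which makes kε > 2 strict.
    d = 2 ℕ.+ a
    k = suc j

    2<kε : fromℕ 2 < fromℕ k * ε
    2<kε = begin-strict
      fromℕ 2              ≡⟨ *-identityʳ _ ⟨
      fromℕ 2 * 1#         ≡⟨ cong (fromℕ 2 *_) (⁻¹-inverseˡ (pos⇒≢0 0<ε)) ⟨
      fromℕ 2 * (ε ⁻¹ * ε) ≡⟨ *-assoc _ _ _ ⟨
      fromℕ 2 * ε ⁻¹ * ε   <⟨ *-monoˡ-< 0<ε 2/ε<k ⟩
      fromℕ k * ε          ∎

    ε<1 : ε < 1#
    ε<1 = ≰⇒> 1≰ε

    complexity : ∀ f → fromℕ (queryComplexity f (tester P d k)) ≤ fromℕ 24 * ε ⁻¹ * log₂ (suc (suc m))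
    complexity f = begin
      fromℕ (queryComplexity f (tester P d k))
        ≤⟨ fromℕ-mono-≤ (ℕ.≤-trans (queryComplexity-tester P f d k) (ℕ.*-monoʳ-≤ k (2+n≤8*n a))) ⟩
      fromℕ (k ℕ.* (8 ℕ.* suc a))
        ≡⟨ ×1-homo-* k (8 ℕ.* suc a) ⟩
      fromℕ k * fromℕ (8 ℕ.* suc a)
        ≡⟨ cong (fromℕ k *_) (×1-homo-* 8 (suc a)) ⟩
      fromℕ k * (fromℕ 8 * fromℕ (suc a))
        ≤⟨ *-mono-≤ (fromℕ-nonNeg k) (*-nonNeg (fromℕ-nonNeg 8) (≤-trans (fromℕ-nonNeg (suc a)) a≤log))
             (rounds≤3/ε j 0<ε ε<1 j≤2/ε) (*-monoʳ-≤ (fromℕ-nonNeg 8) a≤log) ⟩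
      fromℕ 3 * ε ⁻¹ * (fromℕ 8 * log₂ (suc (suc m)))
        ≡⟨ solve 4 (λ x y e l → x :* e :* (y :* l) := x :* y :* e :* l) refl (fromℕ 3) (fromℕ 8) (ε ⁻¹) (log₂ (suc (suc m))) ⟩
      fromℕ 3 * fromℕ 8 * ε ⁻¹ * log₂ (suc (suc m))
        ≡⟨ cong (λ w → w * ε ⁻¹ * log₂ (suc (suc m))) (×1-homo-* 3 8) ⟨
      fromℕ 24 * ε ⁻¹ * log₂ (suc (suc m)) ∎
      where
      a≤log : fromℕ (suc a) ≤ log₂ (suc (suc m))
      a≤log = fromℕ≤log₂ (suc a) 2^a≤n

theorem4p4 : ∀ {r} (𝓡 : RealNumbers r) →
    let open PropertyTesting 𝓡 in
    (m : ℕ) (P : BoundedDerivativeProperty m) (ε : ℝ) → 0# < ε →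
    Σ (Algorithm (suc m)) λ T →
    IsDistributionFreeTester ⟦ P ⟧ ε T ×
    (∀ (f : Fin (suc m) → ℝ) → fromℕ (queryComplexity f T) ≤ fromℕ 24 * ε ⁻¹ * log₂ (suc m))
theorem4p4 = BisectionTester.bisection-tester
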